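{- Let $G$ be a simple undirected graph on vertices $\{1,\dots,n\}$ and let $A_G$ be its adjacency matrix. Then $\mathrm{Aut}(G)$, regarded as a group of permutation matrices, is the set of matrices $P=[P_{i,j}]_{i,j=1}^n$ given by the zeroes in $\mathbb{R}^{n\times n}$ of the ideal $I_G\subseteq\mathbb{R}[P_{i,j}:1\le i,j\le n]$ generated from the equations $$(PA_G-A_GP)_{i,j}=0,\ \ 1\le i,j\le n;\qquad \sum_{i=1}^nP_{i,j}=1,\ \ 1\le j\le n;$$ $$\sum_{j=1}^nP_{i,j}=1,\ \ 1\le i\le n;\qquad P_{i,j}^2-P_{i,j}=0,\ \ 1\le i,j\le n.$$
   Context: $\mathrm{Aut}(G)$ is the group of permutations of the vertices of $G$ that preserve edge adjacency, each permutation being identified with its $n\times n$ permutation matrix. -}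

module Defs where

open import Algebra.Bundles using (CommutativeRing; Group)
open import Algebra.Structures using (IsCommutativeRing)
open import Data.Bool.Base using (if_then_else_)
open import Data.Fin.Base using (Fin)
import Data.Fin.Properties as Fin
open import Data.Fin.Permutation as Perm using (Permutation′; _⟨$⟩ʳ_; _⟨$⟩ˡ_)
open import Data.Nat.Base as ℕ using (ℕ)
import Data.Nat.Properties as ℕ
open import Data.Product.Base using (_×_; _,_; ∃)
open import Data.Rational.Base as ℚ using (ℚ; 0ℚ; 1ℚ; ½; positive; _<_; ∣_∣)
import Data.Rational.Properties as ℚ
open import Data.Rational.Solver using (module +-*-Solver)
open import Function.Base using (_∘_)
open import Function.Bundles using (_⇔_; mk⇔; Equivalence)
open import Level using (0ℓ; _⊔_)
open import Relation.Binary.Core using (Rel)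
open import Relation.Binary.Definitions using (Decidable; Symmetric; Irreflexive)
open import Relation.Binary.PropositionalEquality
  using (_≡_; refl; sym; trans; cong; subst; subst₂)
open import Relation.Binary.Structures using (IsEquivalence)
open import Relation.Nullary using (does)
open import Relation.Unary using (Pred; _∈_)
import Algebra.Definitions.RawMonoid as RawMonoidDefs

-- ℝ is Cantor's completion: rational Cauchy sequences modulo null sequences.

IsCauchy : (ℕ → ℚ) → Set
IsCauchy x = ∀ ε → 0ℚ < ε →
  ∃ λ N → ∀ m n → N ℕ.≤ m → N ℕ.≤ n → ∣ x m ℚ.- x n ∣ < ε

record CauchySeq : Set where
  constructor mkCauchy
  field
    seq    : ℕ → ℚ
    cauchy : IsCauchy seq

open CauchySeq public

infix 4 _≈ᶜ_

_≈ᶜ_ : Rel CauchySeq 0ℓ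
x ≈ᶜ y = ∀ ε → 0ℚ < ε → ∃ λ N → ∀ n → N ℕ.≤ n → ∣ seq x n ℚ.- seq y n ∣ < ε

module RationalLemmas where
  open +-*-Solver

  half>0 : ∀ {ε} → 0ℚ < ε → 0ℚ < ½ ℚ.* ε
  half>0 {ε} ε>0 = ℚ.positive⁻¹ (½ ℚ.* ε) {{ℚ.pos*pos⇒pos ½ ε {{positive ε>0}}}}

  half+half : ∀ ε → ½ ℚ.* ε ℚ.+ ½ ℚ.* ε ≡ ε
  half+half ε = trans (sym (ℚ.*-distribʳ-+ ε ½ ½)) (ℚ.*-identityˡ ε)

  divide : ∀ {A ε} → 0ℚ < A → 0ℚ < ε → ∃ λ δ → 0ℚ < δ × A ℚ.* δ ≡ ε
  divide {A} {ε} A>0 ε>0 =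
    A⁻¹ ℚ.* ε
    , ℚ.positive⁻¹ (A⁻¹ ℚ.* ε) {{ℚ.pos*pos⇒pos A⁻¹ {{ℚ.1/pos⇒pos A}} ε}}
    , trans (sym (ℚ.*-assoc A A⁻¹ ε))
        (trans (cong (ℚ._* ε) (ℚ.*-inverseʳ A)) (ℚ.*-identityˡ ε))
    where
    instance
      posA = positive A>0
      posε = positive ε>0
      nzA  = ℚ.pos⇒nonZero A
    A⁻¹ = ℚ.1/ A

  x-x : ∀ x → ∣ x ℚ.- x ∣ ≡ 0ℚ
  x-x x = cong ∣_∣ (ℚ.+-inverseʳ x)

  dist-sym : ∀ x y → ∣ x ℚ.- y ∣ ≡ ∣ y ℚ.- x ∣
  dist-sym x y = trans (cong ∣_∣ (neg-sub x y)) (ℚ.∣-p∣≡∣p∣ (y ℚ.- x))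
    where
    neg-sub : ∀ x y → x ℚ.- y ≡ ℚ.- (y ℚ.- x)
    neg-sub = solve 2 (λ x y → x :- y := :- (y :- x)) refl

  dist-trans : ∀ x y z {δ ε} → ∣ x ℚ.- y ∣ < δ → ∣ y ℚ.- z ∣ < ε →
               ∣ x ℚ.- z ∣ < δ ℚ.+ ε
  dist-trans x y z p q = ℚ.≤-<-trans
    (subst (λ w → ∣ w ∣ ℚ.≤ ∣ x ℚ.- y ∣ ℚ.+ ∣ y ℚ.- z ∣) (telescope x y z)
      (ℚ.∣p+q∣≤∣p∣+∣q∣ (x ℚ.- y) (y ℚ.- z)))
    (ℚ.+-mono-< p q)
    where
    telescope : ∀ x y z → (x ℚ.- y) ℚ.+ (y ℚ.- z) ≡ x ℚ.- z
    telescope = solve 3 (λ x y z → (x :- y) :+ (y :- z) := x :- z) refl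

  dist-+ : ∀ a b c d {δ ε} → ∣ a ℚ.- c ∣ < δ → ∣ b ℚ.- d ∣ < ε →
           ∣ (a ℚ.+ b) ℚ.- (c ℚ.+ d) ∣ < δ ℚ.+ ε
  dist-+ a b c d p q = ℚ.≤-<-trans
    (subst (λ w → ∣ w ∣ ℚ.≤ ∣ a ℚ.- c ∣ ℚ.+ ∣ b ℚ.- d ∣) (shuffle a b c d)
      (ℚ.∣p+q∣≤∣p∣+∣q∣ (a ℚ.- c) (b ℚ.- d)))
    (ℚ.+-mono-< p q)
    where
    shuffle : ∀ a b c d → (a ℚ.- c) ℚ.+ (b ℚ.- d) ≡ (a ℚ.+ b) ℚ.- (c ℚ.+ d)
    shuffle = solve 4 (λ a b c d → (a :- c) :+ (b :- d) := (a :+ b) :- (c :+ d)) refl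

  dist-neg : ∀ a b → ∣ (ℚ.- a) ℚ.- (ℚ.- b) ∣ ≡ ∣ a ℚ.- b ∣
  dist-neg a b = trans (cong ∣_∣ (neg-neg a b)) (dist-sym b a)
    where
    neg-neg : ∀ a b → (ℚ.- a) ℚ.- (ℚ.- b) ≡ b ℚ.- a
    neg-neg = solve 2 (λ a b → (:- a) :- (:- b) := b :- a) refl

  ∣*∣-bound : ∀ x y {A δ} → 0ℚ < A → ∣ x ∣ < A → ∣ y ∣ < δ → ∣ x ℚ.* y ∣ < A ℚ.* δ
  ∣*∣-bound x y {A} {δ} A>0 p q = subst (_< A ℚ.* δ) (sym (ℚ.∣p*q∣≡∣p∣*∣q∣ x y))
    (ℚ.≤-<-trans
      (ℚ.*-monoʳ-≤-nonNeg ∣ y ∣ {{ℚ.∣-∣-nonNeg y}} (ℚ.<⇒≤ p))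
      (ℚ.*-monoʳ-<-pos A {{positive A>0}} q))

  dist-* : ∀ a b c d {A B δ ε} → 0ℚ < A → 0ℚ < B → ∣ a ∣ < A → ∣ d ∣ < B →
           ∣ a ℚ.- c ∣ < δ → ∣ b ℚ.- d ∣ < δ →
           (A ℚ.+ B) ℚ.* δ ≡ ε → ∣ a ℚ.* b ℚ.- c ℚ.* d ∣ < ε
  dist-* a b c d {A} {B} {δ} A>0 B>0 ∣a∣<A ∣d∣<B p q eq =
    subst₂ _<_ (cong ∣_∣ (expand a b c d)) (trans (sym (ℚ.*-distribʳ-+ δ A B)) eq)
      (ℚ.≤-<-trans (ℚ.∣p+q∣≤∣p∣+∣q∣ (a ℚ.* (b ℚ.- d)) (d ℚ.* (a ℚ.- c)))
        (ℚ.+-mono-< (∣*∣-bound a (b ℚ.- d) A>0 ∣a∣<A q)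
                    (∣*∣-bound d (a ℚ.- c) B>0 ∣d∣<B p)))
    where
    expand : ∀ a b c d → a ℚ.* (b ℚ.- d) ℚ.+ d ℚ.* (a ℚ.- c) ≡ a ℚ.* b ℚ.- c ℚ.* d
    expand = solve 4
      (λ a b c d → a :* (b :- d) :+ d :* (a :- c) := a :* b :- c :* d) refl

  ∣∣-near : ∀ x y → ∣ x ℚ.- y ∣ < 1ℚ → ∣ x ∣ < 1ℚ ℚ.+ ∣ y ∣
  ∣∣-near x y p = ℚ.≤-<-trans
    (subst (λ w → ∣ w ∣ ℚ.≤ ∣ x ℚ.- y ∣ ℚ.+ ∣ y ∣) (cancel x y)
      (ℚ.∣p+q∣≤∣p∣+∣q∣ (x ℚ.- y) y))
    (ℚ.+-monoˡ-< ∣ y ∣ p)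
    where
    cancel : ∀ x y → (x ℚ.- y) ℚ.+ y ≡ x
    cancel = solve 2 (λ x y → (x :- y) :+ y := x) refl

open RationalLemmas

eventuallyBounded : ∀ x → ∃ λ A → 0ℚ < A × ∃ λ N → ∀ n → N ℕ.≤ n → ∣ seq x n ∣ < A
eventuallyBounded x =
  let N , close = cauchy x 1ℚ (ℚ.positive⁻¹ 1ℚ) in
  1ℚ ℚ.+ ∣ seq x N ∣
  , ℚ.positive⁻¹ _ {{ℚ.pos+nonNeg⇒pos 1ℚ ∣ seq x N ∣ {{ℚ.∣-∣-nonNeg (seq x N)}}}}
  , N , λ n N≤n → ∣∣-near (seq x n) (seq x N) (close n N N≤n ℕ.≤-refl)

infixl 6 _+ᶜ_
infixl 7 _*ᶜ_
infix  8 -ᶜ_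

constᶜ : ℚ → CauchySeq
constᶜ q = mkCauchy (λ _ → q) λ ε ε>0 →
  0 , λ _ _ _ _ → subst (_< ε) (sym (x-x q)) ε>0

_+ᶜ_ : CauchySeq → CauchySeq → CauchySeq
x +ᶜ y = mkCauchy (λ n → seq x n ℚ.+ seq y n) cau
  where
  cau : IsCauchy (λ n → seq x n ℚ.+ seq y n)
  cau ε ε>0 =
    let M , p = cauchy x (½ ℚ.* ε) (half>0 ε>0)
        N , q = cauchy y (½ ℚ.* ε) (half>0 ε>0)
    in M ℕ.⊔ N , λ m n m≥ n≥ → subst (_ <_) (half+half ε)
      (dist-+ (seq x m) (seq y m) (seq x n) (seq y n)
        (p m n (ℕ.m⊔n≤o⇒m≤o M N m≥) (ℕ.m⊔n≤o⇒m≤o M N n≥))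
        (q m n (ℕ.m⊔n≤o⇒n≤o M N m≥) (ℕ.m⊔n≤o⇒n≤o M N n≥)))

-ᶜ_ : CauchySeq → CauchySeq
-ᶜ x = mkCauchy (λ n → ℚ.- seq x n) λ ε ε>0 →
  let N , p = cauchy x ε ε>0 in
  N , λ m n m≥ n≥ →
    subst (_< ε) (sym (dist-neg (seq x m) (seq x n))) (p m n m≥ n≥)

_*ᶜ_ : CauchySeq → CauchySeq → CauchySeq
x *ᶜ y = mkCauchy (λ n → seq x n ℚ.* seq y n) cau
  where
  cau : IsCauchy (λ n → seq x n ℚ.* seq y n)
  cau ε ε>0 =
    let A , A>0 , K , ∣x∣<A = eventuallyBounded x
        B , B>0 , L , ∣y∣<B = eventuallyBounded y
        δ , δ>0 , eq = divide (ℚ.+-mono-< A>0 B>0) ε>0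
        M , p = cauchy x δ δ>0
        N , q = cauchy y δ δ>0
    in (K ℕ.⊔ L) ℕ.⊔ (M ℕ.⊔ N) , λ m n m≥ n≥ →
    let KL≤m = ℕ.m⊔n≤o⇒m≤o (K ℕ.⊔ L) (M ℕ.⊔ N) m≥
        KL≤n = ℕ.m⊔n≤o⇒m≤o (K ℕ.⊔ L) (M ℕ.⊔ N) n≥
        MN≤m = ℕ.m⊔n≤o⇒n≤o (K ℕ.⊔ L) (M ℕ.⊔ N) m≥
        MN≤n = ℕ.m⊔n≤o⇒n≤o (K ℕ.⊔ L) (M ℕ.⊔ N) n≥
    in dist-* (seq x m) (seq y m) (seq x n) (seq y n) A>0 B>0
        (∣x∣<A m (ℕ.m⊔n≤o⇒m≤o K L KL≤m))
        (∣y∣<B n (ℕ.m⊔n≤o⇒n≤o K L KL≤n))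
        (p m n (ℕ.m⊔n≤o⇒m≤o M N MN≤m) (ℕ.m⊔n≤o⇒m≤o M N MN≤n))
        (q m n (ℕ.m⊔n≤o⇒n≤o M N MN≤m) (ℕ.m⊔n≤o⇒n≤o M N MN≤n))
        eq

pointwise⇒≈ᶜ : ∀ {x y} → (∀ n → seq x n ≡ seq y n) → x ≈ᶜ y
pointwise⇒≈ᶜ {x} {y} eq ε ε>0 = 0 , λ n _ →
  subst (_< ε) (sym (trans (cong (λ w → ∣ w ℚ.- seq y n ∣) (eq n)) (x-x (seq y n)))) ε>0

≈ᶜ-isEquivalence : IsEquivalence _≈ᶜ_
≈ᶜ-isEquivalence = record
  { refl  = λ {x} → pointwise⇒≈ᶜ {x} {x} λ _ → refl
  ; sym   = λ {x} {y} x≈y ε ε>0 →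
      let N , p = x≈y ε ε>0 in
      N , λ n n≥ → subst (_< ε) (dist-sym (seq x n) (seq y n)) (p n n≥)
  ; trans = λ {x} {y} {z} x≈y y≈z ε ε>0 →
      let M , p = x≈y (½ ℚ.* ε) (half>0 ε>0)
          N , q = y≈z (½ ℚ.* ε) (half>0 ε>0)
      in M ℕ.⊔ N , λ n n≥ → subst (_ <_) (half+half ε)
           (dist-trans (seq x n) (seq y n) (seq z n)
             (p n (ℕ.m⊔n≤o⇒m≤o M N n≥)) (q n (ℕ.m⊔n≤o⇒n≤o M N n≥)))
  }

+ᶜ-cong : ∀ {x y u v} → x ≈ᶜ y → u ≈ᶜ v → x +ᶜ u ≈ᶜ y +ᶜ v
+ᶜ-cong {x} {y} {u} {v} x≈y u≈v ε ε>0 =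
  let M , p = x≈y (½ ℚ.* ε) (half>0 ε>0)
      N , q = u≈v (½ ℚ.* ε) (half>0 ε>0)
  in M ℕ.⊔ N , λ n n≥ → subst (_ <_) (half+half ε)
       (dist-+ (seq x n) (seq u n) (seq y n) (seq v n)
         (p n (ℕ.m⊔n≤o⇒m≤o M N n≥)) (q n (ℕ.m⊔n≤o⇒n≤o M N n≥)))

*ᶜ-cong : ∀ {x y u v} → x ≈ᶜ y → u ≈ᶜ v → x *ᶜ u ≈ᶜ y *ᶜ v
*ᶜ-cong {x} {y} {u} {v} x≈y u≈v ε ε>0 =
  let A , A>0 , K , ∣x∣<A = eventuallyBounded x
      B , B>0 , L , ∣v∣<B = eventuallyBounded v
      δ , δ>0 , eq = divide (ℚ.+-mono-< A>0 B>0) ε>0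
      M , p = x≈y δ δ>0
      N , q = u≈v δ δ>0
  in (K ℕ.⊔ L) ℕ.⊔ (M ℕ.⊔ N) , λ n n≥ →
  let KL≤n = ℕ.m⊔n≤o⇒m≤o (K ℕ.⊔ L) (M ℕ.⊔ N) n≥
      MN≤n = ℕ.m⊔n≤o⇒n≤o (K ℕ.⊔ L) (M ℕ.⊔ N) n≥
  in dist-* (seq x n) (seq u n) (seq y n) (seq v n) A>0 B>0
      (∣x∣<A n (ℕ.m⊔n≤o⇒m≤o K L KL≤n))
      (∣v∣<B n (ℕ.m⊔n≤o⇒n≤o K L KL≤n))
      (p n (ℕ.m⊔n≤o⇒m≤o M N MN≤n))
      (q n (ℕ.m⊔n≤o⇒n≤o M N MN≤n))
      eq

-ᶜ-cong : ∀ {x y} → x ≈ᶜ y → -ᶜ x ≈ᶜ -ᶜ y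
-ᶜ-cong {x} {y} x≈y ε ε>0 =
  let N , p = x≈y ε ε>0 in
  N , λ n n≥ → subst (_< ε) (sym (dist-neg (seq x n) (seq y n))) (p n n≥)

ℝ-isCommutativeRing : IsCommutativeRing _≈ᶜ_ _+ᶜ_ _*ᶜ_ -ᶜ_ (constᶜ 0ℚ) (constᶜ 1ℚ)
ℝ-isCommutativeRing = record
  { isRing = record
    { +-isAbelianGroup = record
      { isGroup = record
        { isMonoid = record
          { isSemigroup = record
            { isMagma = record
              { isEquivalence = ≈ᶜ-isEquivalence
              ; ∙-cong = λ {x} {y} {u} {v} → +ᶜ-cong {x} {y} {u} {v}
              }
            ; assoc = λ x y z → pointwise⇒≈ᶜ {(x +ᶜ y) +ᶜ z} {x +ᶜ (y +ᶜ z)}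
                λ n → ℚ.+-assoc (seq x n) (seq y n) (seq z n)
            }
          ; identity =
              (λ x → pointwise⇒≈ᶜ {constᶜ 0ℚ +ᶜ x} {x} λ n → ℚ.+-identityˡ (seq x n))
            , (λ x → pointwise⇒≈ᶜ {x +ᶜ constᶜ 0ℚ} {x} λ n → ℚ.+-identityʳ (seq x n))
          }
        ; inverse =
            (λ x → pointwise⇒≈ᶜ { -ᶜ x +ᶜ x} {constᶜ 0ℚ} λ n → ℚ.+-inverseˡ (seq x n))
          , (λ x → pointwise⇒≈ᶜ {x +ᶜ -ᶜ x} {constᶜ 0ℚ} λ n → ℚ.+-inverseʳ (seq x n))
        ; ⁻¹-cong = λ {x} {y} → -ᶜ-cong {x} {y}
        }
      ; comm = λ x y → pointwise⇒≈ᶜ {x +ᶜ y} {y +ᶜ x}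
          λ n → ℚ.+-comm (seq x n) (seq y n)
      }
    ; *-cong = λ {x} {y} {u} {v} → *ᶜ-cong {x} {y} {u} {v}
    ; *-assoc = λ x y z → pointwise⇒≈ᶜ {(x *ᶜ y) *ᶜ z} {x *ᶜ (y *ᶜ z)}
        λ n → ℚ.*-assoc (seq x n) (seq y n) (seq z n)
    ; *-identity =
        (λ x → pointwise⇒≈ᶜ {constᶜ 1ℚ *ᶜ x} {x} λ n → ℚ.*-identityˡ (seq x n))
      , (λ x → pointwise⇒≈ᶜ {x *ᶜ constᶜ 1ℚ} {x} λ n → ℚ.*-identityʳ (seq x n))
    ; distrib =
        (λ x y z → pointwise⇒≈ᶜ {x *ᶜ (y +ᶜ z)} {x *ᶜ y +ᶜ x *ᶜ z}
          λ n → ℚ.*-distribˡ-+ (seq x n) (seq y n) (seq z n))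
      , (λ x y z → pointwise⇒≈ᶜ {(y +ᶜ z) *ᶜ x} {y *ᶜ x +ᶜ z *ᶜ x}
          λ n → ℚ.*-distribʳ-+ (seq x n) (seq y n) (seq z n))
    }
  ; *-comm = λ x y → pointwise⇒≈ᶜ {x *ᶜ y} {y *ᶜ x}
      λ n → ℚ.*-comm (seq x n) (seq y n)
  }

ℝ : CommutativeRing 0ℓ 0ℓ
ℝ = record { isCommutativeRing = ℝ-isCommutativeRing }

-- R[X], presented as the free commutative R-algebra on X: ring expressions
-- modulo the congruence generated by the commutative ring laws and by the
-- requirement that `con` be a ring homomorphism.

module Polynomials {c ℓ} (R : CommutativeRing c ℓ) (X : Set) where
  private module R = CommutativeRing R

  infixl 6 _+ᵖ_
  infixl 7 _*ᵖ_
  infix  8 -ᵖ_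
  infix  4 _≈ᵖ_

  data Poly : Set c where
    con  : R.Carrier → Poly
    var  : X → Poly
    _+ᵖ_ : Poly → Poly → Poly
    _*ᵖ_ : Poly → Poly → Poly
    -ᵖ_  : Poly → Poly

  data _≈ᵖ_ : Rel Poly (c ⊔ ℓ) where
    reflᵖ  : ∀ {f} → f ≈ᵖ f
    symᵖ   : ∀ {f g} → f ≈ᵖ g → g ≈ᵖ f
    transᵖ : ∀ {f g h} → f ≈ᵖ g → g ≈ᵖ h → f ≈ᵖ h

    +-congᵖ : ∀ {f f′ g g′} → f ≈ᵖ f′ → g ≈ᵖ g′ → f +ᵖ g ≈ᵖ f′ +ᵖ g′
    *-congᵖ : ∀ {f f′ g g′} → f ≈ᵖ f′ → g ≈ᵖ g′ → f *ᵖ g ≈ᵖ f′ *ᵖ g′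
    -‿congᵖ : ∀ {f f′} → f ≈ᵖ f′ → -ᵖ f ≈ᵖ -ᵖ f′

    con-cong : ∀ {a b} → a R.≈ b → con a ≈ᵖ con b
    con-+    : ∀ a b → con (a R.+ b) ≈ᵖ con a +ᵖ con b
    con-*    : ∀ a b → con (a R.* b) ≈ᵖ con a *ᵖ con b

    +-assocᵖ     : ∀ f g h → (f +ᵖ g) +ᵖ h ≈ᵖ f +ᵖ (g +ᵖ h)
    +-commᵖ      : ∀ f g → f +ᵖ g ≈ᵖ g +ᵖ f
    +-identityˡᵖ : ∀ f → con R.0# +ᵖ f ≈ᵖ f
    -‿inverseˡᵖ  : ∀ f → -ᵖ f +ᵖ f ≈ᵖ con R.0#
    *-assocᵖ     : ∀ f g h → (f *ᵖ g) *ᵖ h ≈ᵖ f *ᵖ (g *ᵖ h)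
    *-commᵖ      : ∀ f g → f *ᵖ g ≈ᵖ g *ᵖ f
    *-identityˡᵖ : ∀ f → con R.1# *ᵖ f ≈ᵖ f
    distribˡᵖ    : ∀ f g h → f *ᵖ (g +ᵖ h) ≈ᵖ f *ᵖ g +ᵖ f *ᵖ h

  polynomialRing : CommutativeRing c (c ⊔ ℓ)
  polynomialRing = record
    { Carrier = Poly
    ; _≈_ = _≈ᵖ_
    ; _+_ = _+ᵖ_
    ; _*_ = _*ᵖ_
    ; -_  = -ᵖ_
    ; 0#  = con R.0#
    ; 1#  = con R.1#
    ; isCommutativeRing = record
      { isRing = record
        { +-isAbelianGroup = record
          { isGroup = record
            { isMonoid = record
              { isSemigroup = record
                { isMagma = record
                  { isEquivalence = record { refl = reflᵖ ; sym = symᵖ ; trans = transᵖ }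
                  ; ∙-cong = +-congᵖ
                  }
                ; assoc = +-assocᵖ
                }
              ; identity = +-identityˡᵖ
                , λ f → transᵖ (+-commᵖ f _) (+-identityˡᵖ f)
              }
            ; inverse = -‿inverseˡᵖ
              , λ f → transᵖ (+-commᵖ f _) (-‿inverseˡᵖ f)
            ; ⁻¹-cong = -‿congᵖ
            }
          ; comm = +-commᵖ
          }
        ; *-cong = *-congᵖ
        ; *-assoc = *-assocᵖ
        ; *-identity = *-identityˡᵖ
          , λ f → transᵖ (*-commᵖ f _) (*-identityˡᵖ f)
        ; distrib = distribˡᵖ
          , λ f g h → transᵖ (*-commᵖ (g +ᵖ h) f)
              (transᵖ (distribˡᵖ f g h) (+-congᵖ (*-commᵖ f g) (*-commᵖ f h)))
        }
      ; *-comm = *-commᵖ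
      }
    }

  eval : (X → R.Carrier) → Poly → R.Carrier
  eval ρ (con a)  = a
  eval ρ (var x)  = ρ x
  eval ρ (f +ᵖ g) = eval ρ f R.+ eval ρ g
  eval ρ (f *ᵖ g) = eval ρ f R.* eval ρ g
  eval ρ (-ᵖ f)   = R.- eval ρ f

module Ideals {c ℓ} (R : CommutativeRing c ℓ) where
  open CommutativeRing R

  data ⟨_⟩ {s} (S : Pred Carrier s) : Pred Carrier (c ⊔ ℓ ⊔ s) where
    gen : ∀ {a} → a ∈ S → a ∈ ⟨ S ⟩
    ∈-0 : 0# ∈ ⟨ S ⟩
    ∈-+ : ∀ {a b} → a ∈ ⟨ S ⟩ → b ∈ ⟨ S ⟩ → a + b ∈ ⟨ S ⟩
    ∈-* : ∀ r {a} → a ∈ ⟨ S ⟩ → r * a ∈ ⟨ S ⟩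
    ∈-≈ : ∀ {a b} → a ≈ b → a ∈ ⟨ S ⟩ → b ∈ ⟨ S ⟩

module Matrices {c ℓ} (R : CommutativeRing c ℓ) where
  open CommutativeRing R
  open RawMonoidDefs +-rawMonoid public using (sum)

  Matrix : ℕ → ℕ → Set c
  Matrix m n = Fin m → Fin n → Carrier

  infix  4 _≈ᴹ_
  infixl 6 _-ᴹ_
  infixl 7 _*ᴹ_

  _≈ᴹ_ : ∀ {m n} → Rel (Matrix m n) ℓ
  A ≈ᴹ B = ∀ i j → A i j ≈ B i j

  _-ᴹ_ : ∀ {m n} → Matrix m n → Matrix m n → Matrix m n
  (A -ᴹ B) i j = A i j - B i j

  _*ᴹ_ : ∀ {m n p} → Matrix m n → Matrix n p → Matrix m p
  (A *ᴹ B) i k = sum λ j → A i j * B j k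

-- Decidability of adjacency holds classically; it is what makes the 0/1
-- entries of the adjacency matrix definable.

record SimpleGraph (n : ℕ) : Set₁ where
  infix 4 _~_ _~?_
  field
    _~_    : Rel (Fin n) 0ℓ
    _~?_   : Decidable _~_
    symm   : Symmetric _~_
    irrefl : Irreflexive _≡_ _~_

record Automorphism {n} (G : SimpleGraph n) : Set where
  open SimpleGraph G
  field
    perm      : Permutation′ n
    preserves : ∀ i j → i ~ j ⇔ (perm ⟨$⟩ʳ i) ~ (perm ⟨$⟩ʳ j)

open Automorphism public

Aut : ∀ {n} → SimpleGraph n → Group 0ℓ 0ℓ
Aut G = record
  { Carrier = Automorphism G
  ; _≈_ = λ σ τ → perm σ Perm.≈ perm τ
    -- `Perm._∘ₚ_` composes in diagrammatic order.
  ; _∙_ = λ σ τ → record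
      { perm      = perm τ Perm.∘ₚ perm σ
      ; preserves = λ i j → mk⇔
          (Equivalence.to (preserves σ _ _) ∘ Equivalence.to (preserves τ i j))
          (Equivalence.from (preserves τ i j) ∘ Equivalence.from (preserves σ _ _))
      }
  ; ε = record { perm = Perm.id ; preserves = λ i j → mk⇔ (λ p → p) (λ p → p) }
  ; _⁻¹ = λ σ → record
      { perm      = Perm.flip (perm σ)
      ; preserves = λ i j → mk⇔
          (λ i~j → Equivalence.from (preserves σ _ _)
            (subst₂ _~_ (sym (Perm.inverseʳ (perm σ))) (sym (Perm.inverseʳ (perm σ))) i~j))
          (λ p → subst₂ _~_ (Perm.inverseʳ (perm σ)) (Perm.inverseʳ (perm σ))
            (Equivalence.to (preserves σ _ _) p))
      }
  ; isGroup = record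
    { isMonoid = record
      { isSemigroup = record
        { isMagma = record
          { isEquivalence = record
            { refl  = λ i → refl
            ; sym   = λ p i → sym (p i)
            ; trans = λ p q i → trans (p i) (q i)
            }
          ; ∙-cong = λ {σ} {σ′} {τ} {τ′} p q i →
              trans (cong (perm σ ⟨$⟩ʳ_) (q i)) (p (perm τ′ ⟨$⟩ʳ i))
          }
        ; assoc = λ _ _ _ _ → refl
        }
      ; identity = (λ _ _ → refl) , (λ _ _ → refl)
      }
    ; inverse = (λ σ i → Perm.inverseˡ (perm σ)) , (λ σ i → Perm.inverseʳ (perm σ))
    ; ⁻¹-cong = λ {σ} {τ} p i →
        trans (cong (perm σ ⟨$⟩ˡ_)
          (trans (sym (Perm.inverseʳ (perm τ))) (sym (p (perm τ ⟨$⟩ˡ i)))))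
          (Perm.inverseˡ (perm σ))
    }
  }
  where open SimpleGraph G

module GraphMatrices {c ℓ} (R : CommutativeRing c ℓ) where
  open CommutativeRing R
  open Matrices R

  adjacencyMatrix : ∀ {n} → SimpleGraph n → Matrix n n
  adjacencyMatrix G i j = if does (i ~? j) then 1# else 0#
    where open SimpleGraph G

  -- The convention P e_j = e_{π(j)}, so that π ↦ P is multiplicative.
  permutationMatrix : ∀ {n} → Permutation′ n → Matrix n n
  permutationMatrix π i j = if does (i Fin.≟ (π ⟨$⟩ʳ j)) then 1# else 0#

  automorphismMatrices : ∀ {n} → SimpleGraph n → Pred (Matrix n n) ℓ
  automorphismMatrices G P =
    ∃ λ (σ : Group.Carrier (Aut G)) → P ≈ᴹ permutationMatrix (perm σ)

module GraphIdeal {c ℓ} (R : CommutativeRing c ℓ) {n : ℕ} where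
  open Polynomials R (Fin n × Fin n) public
  open CommutativeRing polynomialRing using (_-_; _*_; 1#)
  open Matrices polynomialRing
  open Ideals polynomialRing public
  private
    module R = CommutativeRing R
    module MR = Matrices R
    module GR = GraphMatrices R

  𝐏 : Matrix n n
  𝐏 i j = var (i , j)

  𝐀 : SimpleGraph n → Matrix n n
  𝐀 G i j = con (GR.adjacencyMatrix G i j)

  data Generator (G : SimpleGraph n) : Pred Poly c where
    commute : ∀ i j → (𝐏 *ᴹ 𝐀 G -ᴹ 𝐀 G *ᴹ 𝐏) i j ∈ Generator G
    colSum  : ∀ j → (sum λ i → 𝐏 i j) - 1# ∈ Generator G
    rowSum  : ∀ i → (sum λ j → 𝐏 i j) - 1# ∈ Generator G
    idem    : ∀ i j → 𝐏 i j * 𝐏 i j - 𝐏 i j ∈ Generator G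

  I : SimpleGraph n → Pred Poly (c ⊔ ℓ)
  I G = ⟨ Generator G ⟩

  zeros : ∀ {s} → Pred Poly s → Pred (MR.Matrix n n) (c ⊔ ℓ ⊔ s)
  zeros J M = ∀ f → f ∈ J → eval (λ (i , j) → M i j) f R.≈ R.0#

{-# OPTIONS --safe #-}

-- A real idempotent is 0 or 1: of the two Cauchy sequences x and x - 1, one is eventually
-- bounded away from 0, so it can be cancelled from x (x - 1) = 0. In a ring without natural
-- torsion, a finite family of zeros and ones with sum 1 contains a single 1, so the row and column
-- equations turn M into the matrix of a permutation π. For such a matrix, (M A)ᵢⱼ = A_{π⁻¹ i, j} and
-- (A M)ᵢⱼ = A_{i, π j}, so that M A = A M says exactly that π preserves adjacency.

module Submission where

open import Defs
open import Algebra.Bundles using (CommutativeMonoid; CommutativeRing)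
import Algebra.Definitions.RawMonoid as RawMonoidDefs
import Algebra.Properties.CommutativeMonoid.Sum as MonoidSum
import Algebra.Properties.Group as GroupProperties
import Algebra.Properties.Ring as RingProperties
open import Data.Bool.Base using (if_then_else_)
open import Data.Fin.Base using (Fin; zero; suc; punchIn; punchOut)
open import Data.Fin.Permutation as Perm using (Permutation′; _⟨$⟩ʳ_; _⟨$⟩ˡ_)
import Data.Fin.Properties as Fin
open import Data.Nat.Base as ℕ using (ℕ; zero; suc)
import Data.Nat.Properties as ℕ
open import Data.Product.Base using (_×_; _,_; ∃; proj₁; proj₂)
open import Data.Rational.Base as ℚ using (0ℚ; 1ℚ; ½; ∣_∣; positive)
import Data.Rational.Properties as ℚ
open import Data.Sum.Base using (_⊎_; inj₁; inj₂)
open import Function.Base using (_∘_)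
open import Function.Bundles using (_⇔_; mk⇔)
open import Relation.Binary.PropositionalEquality as ≡ using (_≡_; _≢_)
open import Relation.Nullary using (¬_; Dec; yes; no; does; contradiction)
open import Relation.Nullary.Decidable using (does-⇔)
open import Relation.Unary using (_≐_; _∈_)
open GraphMatrices ℝ using (automorphismMatrices)
open GraphIdeal ℝ using (I; zeros)

-- Finite sums with at most one nonzero term.

module _ {c ℓ} (M : CommutativeMonoid c ℓ) where
  open CommutativeMonoid M
  open MonoidSum M using (sum; sum-remove; sum-cong-≋; sum-replicate-zero)

  sum-zero : ∀ {n} (f : Fin n → Carrier) → (∀ i → f i ≈ ε) → sum f ≈ ε
  sum-zero {n} f f≈ε = trans (sum-cong-≋ f≈ε) (sum-replicate-zero n)

  sum-single : ∀ {n} (f : Fin n → Carrier) i → (∀ j → j ≢ i → f j ≈ ε) → sum f ≈ f i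
  sum-single {suc n} f i f≈ε = trans (sum-remove f)
    (trans (∙-congˡ (sum-zero (f ∘ punchIn i) λ j → f≈ε _ (Fin.punchInᵢ≢i i j)))
      (identityʳ (f i)))

-- Idempotents and 0/1 indicators.

module _ {c ℓ} (R : CommutativeRing c ℓ) where
  open CommutativeRing R hiding (zero)

  idempotent⇒x[x-1]≈0 : ∀ {x} → x * x ≈ x → x * (x - 1#) ≈ 0#
  idempotent⇒x[x-1]≈0 {x} xx≈x = trans (x[y-z]≈xy-xz x x 1#)
    (x≈y⇒x∙y⁻¹≈ε (trans xx≈x (sym (*-identityʳ x))))
    where
    open GroupProperties +-group using (x≈y⇒x∙y⁻¹≈ε)
    open RingProperties ring using (x[y-z]≈xy-xz)

  indicator : ∀ {a} {A : Set a} → Dec A → Carrier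
  indicator d = if does d then 1# else 0#

  indicator-yes : ∀ {a} {A : Set a} (d : Dec A) → A → indicator d ≈ 1#
  indicator-yes (yes _) _ = refl
  indicator-yes (no ¬a) a = contradiction a ¬a

  indicator-no : ∀ {a} {A : Set a} (d : Dec A) → ¬ A → indicator d ≈ 0#
  indicator-no (yes a) ¬a = contradiction a ¬a
  indicator-no (no _)  _  = refl

  indicator-idem : ∀ {a} {A : Set a} (d : Dec A) → indicator d * indicator d ≈ indicator d
  indicator-idem (yes _) = *-identityˡ 1#
  indicator-idem (no _)  = zeroˡ 0#

  indicator-⇔ : ∀ {a b} {A : Set a} {B : Set b} (d : Dec A) (e : Dec B) →
                A ⇔ B → indicator d ≈ indicator e
  indicator-⇔ d e A⇔B = reflexive (≡.cong (if_then 1# else 0#) (does-⇔ A⇔B d e))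

  -- Recovers adjacency from equal entries of adjacency matrices: if `B` failed, its indicator 0
  -- would equal the indicator 1 of `A`.
  indicator-reflects : ∀ {a b} {A : Set a} {B : Set b} → ¬ 1# ≈ 0# →
                       (d : Dec A) (e : Dec B) → indicator d ≈ indicator e → A → B
  indicator-reflects _   _ (yes b) _   _ = b
  indicator-reflects 1≉0 d (no _)  d≈0 a =
    contradiction (trans (sym (indicator-yes d a)) d≈0) 1≉0

-- Evaluation of polynomials at a point.

module _ {c ℓ} (R : CommutativeRing c ℓ) (X : Set)
         (ρ : X → CommutativeRing.Carrier R) where
  open CommutativeRing R hiding (zero)
  open Polynomials R X
  open Ideals polynomialRing
  private
    module P = Matrices polynomialRing
    module M = Matrices R

  eval-cong : ∀ {f g} → f ≈ᵖ g → eval ρ f ≈ eval ρ g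
  eval-cong reflᵖ              = refl
  eval-cong (symᵖ p)           = sym (eval-cong p)
  eval-cong (transᵖ p q)       = trans (eval-cong p) (eval-cong q)
  eval-cong (+-congᵖ p q)      = +-cong (eval-cong p) (eval-cong q)
  eval-cong (*-congᵖ p q)      = *-cong (eval-cong p) (eval-cong q)
  eval-cong (-‿congᵖ p)        = -‿cong (eval-cong p)
  eval-cong (con-cong p)       = p
  eval-cong (con-+ _ _)        = refl
  eval-cong (con-* _ _)        = refl
  eval-cong (+-assocᵖ _ _ _)   = +-assoc _ _ _
  eval-cong (+-commᵖ _ _)      = +-comm _ _
  eval-cong (+-identityˡᵖ _)   = +-identityˡ _
  eval-cong (-‿inverseˡᵖ _)    = -‿inverseˡ _
  eval-cong (*-assocᵖ _ _ _)   = *-assoc _ _ _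
  eval-cong (*-commᵖ _ _)      = *-comm _ _
  eval-cong (*-identityˡᵖ _)   = *-identityˡ _
  eval-cong (distribˡᵖ _ _ _)  = distribˡ _ _ _

  eval-sum : ∀ {n} (f : Fin n → Poly) → eval ρ (P.sum f) ≈ M.sum (eval ρ ∘ f)
  eval-sum {zero}  f = refl
  eval-sum {suc n} f = +-congˡ (eval-sum (f ∘ suc))

  -- The polynomials vanishing at `ρ` form an ideal, so vanishing need only be checked on
  -- generators.
  eval-⟨⟩ : ∀ {s} {S : Poly → Set s} → (∀ {f} → f ∈ S → eval ρ f ≈ 0#) →
            ∀ {f} → f ∈ ⟨ S ⟩ → eval ρ f ≈ 0#
  eval-⟨⟩ S≈0 (gen f∈S)     = S≈0 f∈S
  eval-⟨⟩ S≈0 ∈-0           = refl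
  eval-⟨⟩ S≈0 (∈-+ p q)     = trans (+-cong (eval-⟨⟩ S≈0 p) (eval-⟨⟩ S≈0 q)) (+-identityˡ 0#)
  eval-⟨⟩ S≈0 (∈-* r p)     = trans (*-congˡ (eval-⟨⟩ S≈0 p)) (zeroʳ (eval ρ r))
  eval-⟨⟩ S≈0 (∈-≈ a≈b p)   = trans (sym (eval-cong a≈b)) (eval-⟨⟩ S≈0 p)

-- The zeros of the ideal as solutions of matrix equations.

module _ {c ℓ} (R : CommutativeRing c ℓ) {n} (G : SimpleGraph n) where
  open CommutativeRing R hiding (zero)
  open GroupProperties +-group using (x≈y⇒x∙y⁻¹≈ε; x∙y⁻¹≈ε⇒x≈y)
  open Matrices R
  open GraphMatrices R using (adjacencyMatrix; permutationMatrix)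
  private
    module GI = GraphIdeal R {n}
    module PM = Matrices GI.polynomialRing
    A = adjacencyMatrix G

  record IsZero (M : Matrix n n) : Set ℓ where
    field
      commute : M *ᴹ A ≈ᴹ A *ᴹ M
      colSum  : ∀ j → sum (λ i → M i j) ≈ 1#
      rowSum  : ∀ i → sum (M i) ≈ 1#
      idem    : ∀ i j → M i j * M i j ≈ M i j

  module _ (M : Matrix n n) where
    private
      ρ : Fin n × Fin n → Carrier
      ρ (i , j) = M i j

      eval-∑ : (f : Fin n → GI.Poly) → GI.eval ρ (PM.sum f) ≈ sum (λ k → GI.eval ρ (f k))
      eval-∑ = eval-sum R (Fin n × Fin n) ρ

      eval-colSum : ∀ j → GI.eval ρ (PM.sum λ i → GI.𝐏 i j) ≈ sum (λ i → M i j)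
      eval-colSum j = eval-∑ λ i → GI.𝐏 i j

      eval-rowSum : ∀ i → GI.eval ρ (PM.sum (GI.𝐏 i)) ≈ sum (M i)
      eval-rowSum i = eval-∑ (GI.𝐏 i)

      -- Polynomial subtraction unfolds to `+ᵖ` and `-ᵖ`, through which `eval` computes; only the
      -- two sums need an argument.
      eval-commute : ∀ i j → GI.eval ρ ((GI.𝐏 PM.*ᴹ GI.𝐀 G PM.-ᴹ GI.𝐀 G PM.*ᴹ GI.𝐏) i j)
                             ≈ (M *ᴹ A) i j - (A *ᴹ M) i j
      eval-commute i j = +-cong
        (eval-∑ λ k → GI.𝐏 i k GI.*ᵖ GI.𝐀 G k j)
        (-‿cong (eval-∑ λ k → GI.𝐀 G i k GI.*ᵖ GI.𝐏 k j))

    IsZero⇒∈zeros : IsZero M → M ∈ GI.zeros (GI.I G)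
    IsZero⇒∈zeros M-zero f = eval-⟨⟩ R (Fin n × Fin n) ρ generator
      where
      open IsZero M-zero
      generator : ∀ {f} → f ∈ GI.Generator G → GI.eval ρ f ≈ 0#
      generator (GI.commute i j) = trans (eval-commute i j) (x≈y⇒x∙y⁻¹≈ε (commute i j))
      generator (GI.colSum j)    = x≈y⇒x∙y⁻¹≈ε (trans (eval-colSum j) (colSum j))
      generator (GI.rowSum i)    = x≈y⇒x∙y⁻¹≈ε (trans (eval-rowSum i) (rowSum i))
      generator (GI.idem i j)    = x≈y⇒x∙y⁻¹≈ε (idem i j)

    ∈zeros⇒IsZero : M ∈ GI.zeros (GI.I G) → IsZero M
    ∈zeros⇒IsZero M∈ = record
      { commute = λ i j → x∙y⁻¹≈ε⇒x≈y _ _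
          (trans (sym (eval-commute i j)) (M∈ _ (GI.gen (GI.commute i j))))
      ; colSum = λ j → trans (sym (eval-colSum j))
          (x∙y⁻¹≈ε⇒x≈y _ _ (M∈ _ (GI.gen (GI.colSum j))))
      ; rowSum = λ i → trans (sym (eval-rowSum i))
          (x∙y⁻¹≈ε⇒x≈y _ _ (M∈ _ (GI.gen (GI.rowSum i))))
      ; idem = λ i j → x∙y⁻¹≈ε⇒x≈y _ _ (M∈ _ (GI.gen (GI.idem i j)))
      }

  -- Products with a permutation matrix.

  module PermutationMatrix {M : Matrix n n} (π : Permutation′ n)
                           (M≈π : M ≈ᴹ permutationMatrix π) where

    entry-1 : ∀ {i j} → i ≡ π ⟨$⟩ʳ j → M i j ≈ 1#
    entry-1 {i} {j} i≡πj = trans (M≈π i j) (indicator-yes R (i Fin.≟ _) i≡πj)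

    entry-0 : ∀ {i j} → i ≢ π ⟨$⟩ʳ j → M i j ≈ 0#
    entry-0 {i} {j} i≢πj = trans (M≈π i j) (indicator-no R (i Fin.≟ _) i≢πj)

    -- Column `j` carries its 1 in row `π j`, hence row `i` carries its 1 in column `π⁻¹ i`.
    row-0 : ∀ {i j} → j ≢ π ⟨$⟩ˡ i → M i j ≈ 0#
    row-0 j≢π⁻¹i = entry-0 λ i≡πj →
      j≢π⁻¹i (≡.trans (≡.sym (Perm.inverseˡ π)) (≡.cong (π ⟨$⟩ˡ_) (≡.sym i≡πj)))

    row-1 : ∀ i → M i (π ⟨$⟩ˡ i) ≈ 1#
    row-1 i = entry-1 (≡.sym (Perm.inverseʳ π))

    M*A : ∀ i j → (M *ᴹ A) i j ≈ A (π ⟨$⟩ˡ i) j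
    M*A i j = trans
      (sum-single +-commutativeMonoid _ (π ⟨$⟩ˡ i) λ k k≢ →
        trans (*-congʳ (row-0 k≢)) (zeroˡ (A k j)))
      (trans (*-congʳ (row-1 i)) (*-identityˡ _))

    A*M : ∀ i j → (A *ᴹ M) i j ≈ A i (π ⟨$⟩ʳ j)
    A*M i j = trans
      (sum-single +-commutativeMonoid _ (π ⟨$⟩ʳ j) λ k k≢ →
        trans (*-congˡ (entry-0 k≢)) (zeroʳ (A i k)))
      (trans (*-congˡ (entry-1 ≡.refl)) (*-identityʳ _))

    colSum-1 : ∀ j → sum (λ i → M i j) ≈ 1#
    colSum-1 j = trans
      (sum-single +-commutativeMonoid _ (π ⟨$⟩ʳ j) λ _ → entry-0) (entry-1 ≡.refl)

    rowSum-1 : ∀ i → sum (M i) ≈ 1#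
    rowSum-1 i = trans
      (sum-single +-commutativeMonoid _ (π ⟨$⟩ˡ i) λ _ → row-0) (row-1 i)

    idempotent : ∀ i j → M i j * M i j ≈ M i j
    idempotent i j = trans (*-cong (M≈π i j) (M≈π i j))
      (trans (indicator-idem R (i Fin.≟ (π ⟨$⟩ʳ j))) (sym (M≈π i j)))

  automorphismMatrix⇒IsZero : ∀ {M} → M ∈ GraphMatrices.automorphismMatrices R G → IsZero M
  automorphismMatrix⇒IsZero {M} (σ , M≈σ) = record
    { commute = λ i j → trans (M*A i j) (trans (A-preserved i j) (sym (A*M i j)))
    ; colSum  = colSum-1
    ; rowSum  = rowSum-1
    ; idem    = idempotent
    }
    where
    open SimpleGraph G
    open PermutationMatrix (perm σ) M≈σ
    A-preserved : ∀ i j → A (perm σ ⟨$⟩ˡ i) j ≈ A i (perm σ ⟨$⟩ʳ j)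
    -- Preservation is applied to the pair `π⁻¹ i`, `j`; then `π (π⁻¹ i)` collapses to `i`.
    A-preserved i j = trans
      (indicator-⇔ R (_ ~? _) (_ ~? _) (preserves σ (perm σ ⟨$⟩ˡ i) j))
      (reflexive (≡.cong (λ k → A k (perm σ ⟨$⟩ʳ j)) (Perm.inverseʳ (perm σ))))

-- Families of zeros and ones in characteristic zero.

NoTorsion : ∀ {c ℓ} → CommutativeRing c ℓ → Set ℓ
NoTorsion R = ∀ k → ¬ suc k · 1# ≈ 0#
  where
  open CommutativeRing R
  open RawMonoidDefs +-rawMonoid using () renaming (_×_ to _·_)

module TorsionFree {c ℓ} (R : CommutativeRing c ℓ) (no-torsion : NoTorsion R) where
  open CommutativeRing R hiding (zero)
  open RawMonoidDefs +-rawMonoid using () renaming (_×_ to _·_)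
  open GroupProperties +-group using (∙-cancelˡ)
  open MonoidSum +-commutativeMonoid using (sum; sum-remove)

  Binary : Carrier → Set ℓ
  Binary x = x ≈ 0# ⊎ x ≈ 1#

  1≉0 : ¬ 1# ≈ 0#
  1≉0 1≈0 = no-torsion 0 (trans (+-identityʳ 1#) 1≈0)

  ≈1? : ∀ {x} → Binary x → Dec (x ≈ 1#)
  ≈1? (inj₁ x≈0) = no λ x≈1 → 1≉0 (trans (sym x≈1) x≈0)
  ≈1? (inj₂ x≈1) = yes x≈1

  ≉1⇒≈0 : ∀ {x} → Binary x → ¬ x ≈ 1# → x ≈ 0#
  ≉1⇒≈0 (inj₁ x≈0) _   = x≈0
  ≉1⇒≈0 (inj₂ x≈1) x≉1 = contradiction x≈1 x≉1

  binary≈indicator : ∀ {x} (b : Binary x) → x ≈ indicator R (≈1? b)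
  binary≈indicator (inj₁ x≈0) = x≈0
  binary≈indicator (inj₂ x≈1) = x≈1

  -- The witness `k` counts the ones, which puts the sum in the form that `no-torsion` speaks about.
  binary-sum : ∀ {n} (f : Fin n → Carrier) → (∀ i → Binary (f i)) →
               ∃ λ k → sum f ≈ k · 1#
  binary-sum {zero}  f b = 0 , refl
  binary-sum {suc n} f b with b zero | binary-sum (f ∘ suc) (b ∘ suc)
  ... | inj₁ f₀≈0 | k , eq = k , trans (+-cong f₀≈0 eq) (+-identityˡ _)
  ... | inj₂ f₀≈1 | k , eq = suc k , +-cong f₀≈1 eq

  -- If `f i` were 1 and the remaining terms added up to `k · 1#`, the total would be `suc k · 1#`,
  -- which is not 0.
  binary-sum≈0 : ∀ {n} (f : Fin n → Carrier) → (∀ i → Binary (f i)) →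
                 sum f ≈ 0# → ∀ i → f i ≈ 0#
  binary-sum≈0 {suc n} f b f≈0 i = ≉1⇒≈0 (b i) λ fi≈1 →
    let k , eq = binary-sum (f ∘ punchIn i) (b ∘ punchIn i) in
    no-torsion k (trans (sym (trans (sum-remove f) (+-cong fi≈1 eq))) f≈0)

  -- Being 1 is decidable for binary elements, so the finite index set can be searched; a failed
  -- search makes every term, and so the sum, 0.
  binary-sum≈1-exists : ∀ {n} {f : Fin n → Carrier} → (∀ i → Binary (f i)) → sum f ≈ 1# →
                        ∃ λ i → f i ≈ 1#
  binary-sum≈1-exists {f = f} b f≈1 with Fin.any? (λ i → ≈1? (b i))
  ... | yes found = found
  ... | no ¬found = contradiction
    (trans (sym f≈1)
      (sum-zero +-commutativeMonoid f λ i → ≉1⇒≈0 (b i) λ fi≈1 → ¬found (i , fi≈1)))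
    1≉0

  -- Removing the term `f i`, which is 1, leaves a binary family with sum 0. All its terms vanish,
  -- among them `f j` when `j` differs from `i`.
  binary-sum≈1-unique : ∀ {n} {f : Fin n → Carrier} → (∀ i → Binary (f i)) → sum f ≈ 1# →
                        ∀ {i j} → f i ≈ 1# → f j ≈ 1# → i ≡ j
  binary-sum≈1-unique {suc n} {f} b f≈1 {i} {j} fi≈1 fj≈1 with i Fin.≟ j
  ... | yes i≡j = i≡j
  ... | no  i≢j = contradiction (trans (sym fj≈1) fj≈0) 1≉0
    where
    rest≈0 : sum (f ∘ punchIn i) ≈ 0#
    rest≈0 = ∙-cancelˡ 1# _ _ (trans (+-congʳ (sym fi≈1))
      (trans (sym (sum-remove f)) (trans f≈1 (sym (+-identityʳ 1#)))))
    fj≈0 : f j ≈ 0#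
    fj≈0 = ≡.subst (λ k → f k ≈ 0#) (Fin.punchIn-punchOut i≢j)
      (binary-sum≈0 (f ∘ punchIn i) (b ∘ punchIn i) rest≈0 (punchOut i≢j))

  -- From a zero of the ideal to an automorphism.

  module _ (idempotent⇒binary : ∀ {x} → x * x ≈ x → Binary x)
           {n} (G : SimpleGraph n) where
    open Matrices R using (_≈ᴹ_)
    open GraphMatrices R using (adjacencyMatrix; permutationMatrix)

    IsZero⇒automorphismMatrix : ∀ {M} → IsZero R G M → M ∈ GraphMatrices.automorphismMatrices R G
    IsZero⇒automorphismMatrix {M} M-zero =
      record { perm = π ; preserves = λ i j → mk⇔
        (indicator-reflects R 1≉0 (_ ~? _) (_ ~? _) (A-preserved i j))
        (indicator-reflects R 1≉0 (_ ~? _) (_ ~? _) (sym (A-preserved i j))) }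
      , M≈π
      where
      open SimpleGraph G
      open IsZero M-zero
      A = adjacencyMatrix G

      binary : ∀ i j → Binary (M i j)
      binary i j = idempotent⇒binary (idem i j)

      column : ∀ j → ∃ λ i → M i j ≈ 1#
      column j = binary-sum≈1-exists (λ i → binary i j) (colSum j)

      row : ∀ i → ∃ λ j → M i j ≈ 1#
      row i = binary-sum≈1-exists (binary i) (rowSum i)

      column-unique : ∀ {i i′ j} → M i j ≈ 1# → M i′ j ≈ 1# → i ≡ i′
      column-unique {j = j} = binary-sum≈1-unique (λ i → binary i j) (colSum j)

      row-unique : ∀ {i j j′} → M i j ≈ 1# → M i j′ ≈ 1# → j ≡ j′
      row-unique {i} = binary-sum≈1-unique (binary i) (rowSum i)

      -- `π` sends a column to the row of its 1, and its inverse sends a row to the column of its 1.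
      -- Uniqueness of these ones makes the two maps mutually inverse.
      π : Permutation′ n
      π = Perm.permutation (proj₁ ∘ column) (proj₁ ∘ row)
        (λ i → column-unique (proj₂ (column _)) (proj₂ (row i)))
        (λ j → row-unique (proj₂ (row _)) (proj₂ (column j)))

      M≈π : M ≈ᴹ permutationMatrix π
      M≈π i j = trans (binary≈indicator (binary i j))
        (indicator-⇔ R (≈1? (binary i j)) (i Fin.≟ (π ⟨$⟩ʳ j)) (mk⇔
          (λ Mij≈1 → column-unique Mij≈1 (proj₂ (column j)))
          λ { ≡.refl → proj₂ (column j) }))

      open PermutationMatrix R G π M≈π using (M*A; A*M)

      A-preserved : ∀ i j → A i j ≈ A (π ⟨$⟩ʳ i) (π ⟨$⟩ʳ j)
      -- The commutation equation is read at row `π i` and column `j`, where `M*A` gives the row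
      -- `π⁻¹ (π i)` of `A`.
      A-preserved i j = trans
        (reflexive (≡.cong (λ k → A k j) (≡.sym (Perm.inverseˡ π))))
        (trans (sym (M*A _ j)) (trans (commute _ j) (A*M _ j)))

-- Idempotents and torsion in the Cauchy reals.

module ℝ = CommutativeRing ℝ

-- Apartness from 0, the positive form of being nonzero: it supplies the bound needed for
-- cancellation.
BoundedAway : CauchySeq → Set
BoundedAway x = ∃ λ c → 0ℚ ℚ.< c × ∃ λ N → ∀ n → N ℕ.≤ n → c ℚ.≤ ∣ seq x n ∣

-- Asking for `x *ᶜ y` to be within `c ℚ.* ε` of 0 gives c|y| ≤ |xy| < cε eventually, and the factor
-- c cancels.
boundedAway-cancel : ∀ x y → BoundedAway x → x *ᶜ y ≈ᶜ constᶜ 0ℚ → y ≈ᶜ constᶜ 0ℚ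
boundedAway-cancel x y (c , c>0 , M , c≤∣x∣) xy≈0 ε ε>0 =
  let N , ∣xy∣<cε = xy≈0 (c ℚ.* ε) (ℚ.positive⁻¹ _ {{ℚ.pos*pos⇒pos c ε}}) in
  M ℕ.⊔ N , λ n n≥ → ℚ.*-cancelˡ-<-nonNeg c {{ℚ.pos⇒nonNeg c}} (begin-strict
    c ℚ.* ∣ seq y n ℚ.- 0ℚ ∣           ≡⟨ ≡.cong (λ z → c ℚ.* ∣ z ∣) (ℚ.+-identityʳ (seq y n)) ⟩
    c ℚ.* ∣ seq y n ∣                  ≤⟨ ℚ.*-monoʳ-≤-nonNeg ∣ seq y n ∣ {{ℚ.∣-∣-nonNeg (seq y n)}}
                                            (c≤∣x∣ n (ℕ.m⊔n≤o⇒m≤o M N n≥)) ⟩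
    ∣ seq x n ∣ ℚ.* ∣ seq y n ∣        ≡⟨ ℚ.∣p*q∣≡∣p∣*∣q∣ (seq x n) (seq y n) ⟨
    ∣ seq x n ℚ.* seq y n ∣            ≡⟨ ≡.cong ∣_∣ (ℚ.+-identityʳ (seq x n ℚ.* seq y n)) ⟨
    ∣ seq x n ℚ.* seq y n ℚ.- 0ℚ ∣     <⟨ ∣xy∣<cε n (ℕ.m⊔n≤o⇒n≤o M N n≥) ⟩
    c ℚ.* ε                            ∎)
  where
  open ℚ.≤-Reasoning
  instance
    posC = positive c>0
    posε = positive ε>0

-- From `N` on, all terms lie within 1/4 of the rational `seq x N`, and comparing its absolute value
-- with 1/2 is decidable.
boundedAway-0∨1 : ∀ x → BoundedAway x ⊎ BoundedAway (x ℝ.- ℝ.1#)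
boundedAway-0∨1 x with cauchy x (½ ℚ.* ½) (ℚ.positive⁻¹ _)
... | N , close with ∣ seq x N ℚ.- 0ℚ ∣ ℚ.<? ½
-- A term within 1/4 of 1 would put 1 at distance less than 1/4 + (1/4 + 1/2) = 1 from 0.
... | yes ∣xN∣<½ = inj₂ (½ ℚ.* ½ , ℚ.positive⁻¹ _ , N , λ n n≥ → ℚ.≮⇒≥ λ ∣xn-1∣<¼ →
  ℚ.<-irrefl ≡.refl
    (RationalLemmas.dist-trans 1ℚ (seq x n) 0ℚ
      (≡.subst (ℚ._< ½ ℚ.* ½) (RationalLemmas.dist-sym (seq x n) 1ℚ) ∣xn-1∣<¼)
      (RationalLemmas.dist-trans (seq x n) (seq x N) 0ℚ (close n N n≥ ℕ.≤-refl) ∣xN∣<½)))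
-- A term within 1/4 of 0 would force |`seq x N`| < 1/4 + 1/4 = 1/2.
... | no ∣xN∣≮½ = inj₁ (½ ℚ.* ½ , ℚ.positive⁻¹ _ , N , λ n n≥ → ℚ.≮⇒≥ λ ∣xn∣<¼ →
  ∣xN∣≮½ (RationalLemmas.dist-trans (seq x N) (seq x n) 0ℚ (close N n ℕ.≤-refl n≥)
    (≡.subst (λ z → ∣ z ∣ ℚ.< ½ ℚ.* ½) (≡.sym (ℚ.+-identityʳ (seq x n))) ∣xn∣<¼)))

ℝ-idempotent⇒0∨1 : ∀ {x} → x ℝ.* x ℝ.≈ x → x ℝ.≈ ℝ.0# ⊎ x ℝ.≈ ℝ.1#
ℝ-idempotent⇒0∨1 {x} xx≈x with boundedAway-0∨1 x
... | inj₁ x-away = inj₂ (GroupProperties.x∙y⁻¹≈ε⇒x≈y ℝ.+-group x ℝ.1#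
  (boundedAway-cancel x (x ℝ.- ℝ.1#) x-away (idempotent⇒x[x-1]≈0 ℝ {x} xx≈x)))
... | inj₂ x-1-away = inj₁ (boundedAway-cancel (x ℝ.- ℝ.1#) x x-1-away
  (ℝ.trans {(x ℝ.- ℝ.1#) ℝ.* x} {x ℝ.* (x ℝ.- ℝ.1#)} {ℝ.0#}
    (ℝ.*-comm (x ℝ.- ℝ.1#) x) (idempotent⇒x[x-1]≈0 ℝ {x} xx≈x)))

open RawMonoidDefs ℝ.+-rawMonoid using () renaming (_×_ to _·_)

·1-nonNeg : ∀ k n → 0ℚ ℚ.≤ seq (k · ℝ.1#) n
·1-nonNeg zero    n = ℚ.≤-refl
·1-nonNeg (suc k) n = ℚ.+-mono-≤ (ℚ.nonNegative⁻¹ 1ℚ) (·1-nonNeg k n)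

-- Every term of the sequence for `suc k · ℝ.1#` is at least 1, so it never comes within 1 of 0.
ℝ-no-torsion : NoTorsion ℝ
ℝ-no-torsion k 1+k≈0 =
  let N , ∣1+k∣<1 = 1+k≈0 1ℚ (ℚ.positive⁻¹ 1ℚ) in
  ℚ.<-irrefl ≡.refl (begin-strict
    1ℚ                                  ≤⟨ ℚ.+-monoʳ-≤ 1ℚ (·1-nonNeg k N) ⟩
    seq (suc k · ℝ.1#) N                ≡⟨ ℚ.0≤p⇒∣p∣≡p (·1-nonNeg (suc k) N) ⟨
    ∣ seq (suc k · ℝ.1#) N ∣            ≡⟨ ≡.cong ∣_∣ (ℚ.+-identityʳ (seq (suc k · ℝ.1#) N)) ⟨
    ∣ seq (suc k · ℝ.1#) N ℚ.- 0ℚ ∣     <⟨ ∣1+k∣<1 N ℕ.≤-refl ⟩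
    1ℚ                                  ∎)
  where open ℚ.≤-Reasoning

proposition1p4 : (n : ℕ) (G : SimpleGraph n) → automorphismMatrices G ≐ zeros (I G)
proposition1p4 n G =
    (λ {M} M-aut → IsZero⇒∈zeros ℝ G M (automorphismMatrix⇒IsZero ℝ G M-aut))
  , λ {M} M∈ → IsZero⇒automorphismMatrix (λ {x} → ℝ-idempotent⇒0∨1 {x}) G (∈zeros⇒IsZero ℝ G M M∈)
  where open TorsionFree ℝ ℝ-no-torsion
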